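{- Let $G$ be a connected simple graph with $n=|V(G)|$ vertices and minimum degree $\delta=\delta(G)$, let $k\in(0,n)$ be a real number, and let $s\ge 1$ be an integer. Each of the following holds. (i) If $G$ has a subgraph $L$ with $\Delta(L)\le 2$ and $|E(L)|\ge 2s$, then $\mu_f(G)\ge s$. In particular, if $G$ has a cycle or path with at least $2\delta$ edges, then $\mu_f(G)\ge\delta$. (ii) If $\delta>\frac{n-k}{2}$, then $\mu_f(G)>\frac{n-k}{2}$.
   Context: Graphs are finite, simple and undirected; $\Delta(L)$ is the maximum degree of $L$. A fractional matching of $G$ is a function $f:E(G)\to[0,1]$ such that for every vertex $v$ the sum of $f(e)$ over all edges $e$ incident with $v$ is at most $1$. The fractional matching number is $\mu_f(G)=\max\{\sum_{e\in E(G)}f(e): f \text{ is a fractional matching of } G\}$. -}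

module Defs where

open import Data.Nat.Base as ℕ using (ℕ; suc)
import Data.Nat.Properties as ℕ
open import Data.Integer.Base using (+_)
open import Data.Rational.Base as ℚ using (ℚ; 0ℚ; 1ℚ; ½)
import Data.Rational.Properties as ℚ
open import Data.Rational.Solver using (module +-*-Solver)
open import Data.Fin.Base as Fin using (Fin; inject₁; fromℕ)
import Data.Fin.Properties as Fin
open import Data.Fin.Subset using (Subset; _∈_)
open import Data.Fin.Subset.Properties using (_∈?_)
open import Data.List.Base
  using (List; map; filter; mapMaybe; foldr; length; allFin; cartesianProduct)
open import Data.List.Extrema.Nat using (min; max)
import Data.Maybe.Base as Maybe
open import Data.Maybe.Base using (Maybe)
open import Data.Product.Base using (∃; _×_; _,_)
open import Data.Sum.Base using (_⊎_)
open import Function.Definitions using (Injective)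
open import Relation.Binary.Construct.Closure.ReflexiveTransitive using (Star)
open import Relation.Binary.Core using (Rel)
open import Relation.Binary.Definitions using (Decidable; Symmetric)
open import Relation.Binary.PropositionalEquality
  using (_≡_; refl; sym; trans; cong; cong₂; subst)
open import Relation.Nullary using (¬_; Dec; dec⇒maybe; _×-dec_; _⊎-dec_)
open import Level using (0ℓ)

------------------------------------------------------------------------
-- Real numbers, as Cauchy sequences of rationals.  Two sequences denote
-- the same real number when they are related by _≃ᵣ_.

IsCauchy : (ℕ → ℚ) → Set
IsCauchy x = ∀ ε → 0ℚ ℚ.< ε →
  ∃ λ N → ∀ m n → N ℕ.≤ m → N ℕ.≤ n → ℚ.∣ x m ℚ.- x n ∣ ℚ.< ε

record ℝ : Set where
  constructor mkℝ
  field
    seq    : ℕ → ℚ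
    cauchy : IsCauchy seq

open ℝ public

infix  4 _≤ᵣ_ _<ᵣ_ _≃ᵣ_
infixl 6 _+ᵣ_ _-ᵣ_
infixl 7 _/2
infix  8 -ᵣ_

_≤ᵣ_ : Rel ℝ 0ℓ
x ≤ᵣ y = ∀ ε → 0ℚ ℚ.< ε → ∃ λ N → ∀ n → N ℕ.≤ n → seq x n ℚ.≤ seq y n ℚ.+ ε

_<ᵣ_ : Rel ℝ 0ℓ
x <ᵣ y = ∃ λ ε → 0ℚ ℚ.< ε × ∃ λ N → ∀ n → N ℕ.≤ n → seq x n ℚ.+ ε ℚ.≤ seq y n

_≃ᵣ_ : Rel ℝ 0ℓ
x ≃ᵣ y = x ≤ᵣ y × y ≤ᵣ x

fromℚ : ℚ → ℝ
fromℚ q = mkℝ (λ _ → q) λ ε 0<ε →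
  0 , λ _ _ _ _ → subst (ℚ._< ε) (sym (cong ℚ.∣_∣ (ℚ.+-inverseʳ q))) 0<ε

fromNat : ℕ → ℝ
fromNat m = fromℚ (+ m ℚ./ 1)

0ᵣ 1ᵣ : ℝ
0ᵣ = fromℚ 0ℚ
1ᵣ = fromℚ 1ℚ

private
  module S = +-*-Solver

  0<½* : ∀ {ε} → 0ℚ ℚ.< ε → 0ℚ ℚ.< ½ ℚ.* ε
  0<½* {ε} 0<ε =
    subst (ℚ._< ½ ℚ.* ε) (ℚ.*-zeroʳ ½) (ℚ.*-monoʳ-<-pos ½ 0<ε)

  ½*+½* : ∀ ε → ½ ℚ.* ε ℚ.+ ½ ℚ.* ε ≡ ε
  ½*+½* ε = trans (sym (ℚ.*-distribʳ-+ ε ½ ½)) (ℚ.*-identityˡ ε)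

  interchange : ∀ a b c d →
    (a ℚ.+ b) ℚ.- (c ℚ.+ d) ≡ (a ℚ.- c) ℚ.+ (b ℚ.- d)
  interchange = S.solve 4
    (λ a b c d → (a S.:+ b) S.:- (c S.:+ d) S.:= (a S.:- c) S.:+ (b S.:- d))
    refl

  neg-diff : ∀ a b → (ℚ.- a) ℚ.- (ℚ.- b) ≡ ℚ.- (a ℚ.- b)
  neg-diff = S.solve 2
    (λ a b → (S.:- a) S.:- (S.:- b) S.:= S.:- (a S.:- b)) refl

  half-diff : ∀ a b → ½ ℚ.* a ℚ.- ½ ℚ.* b ≡ ½ ℚ.* (a ℚ.- b)
  half-diff = S.solve 2
    (λ a b → S.con ½ S.:* a S.:- S.con ½ S.:* b
             S.:= S.con ½ S.:* (a S.:- b)) refl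

_+ᵣ_ : ℝ → ℝ → ℝ
x +ᵣ y = mkℝ (λ n → seq x n ℚ.+ seq y n) +-cauchy
  where
  +-cauchy : IsCauchy (λ n → seq x n ℚ.+ seq y n)
  +-cauchy ε 0<ε
    with cauchy x (½ ℚ.* ε) (0<½* 0<ε) | cauchy y (½ ℚ.* ε) (0<½* 0<ε)
  ... | M , hx | N , hy = M ℕ.⊔ N , λ m n p q → begin-strict
    ℚ.∣ (seq x m ℚ.+ seq y m) ℚ.- (seq x n ℚ.+ seq y n) ∣
      ≡⟨ cong ℚ.∣_∣ (interchange (seq x m) (seq y m) (seq x n) (seq y n)) ⟩
    ℚ.∣ (seq x m ℚ.- seq x n) ℚ.+ (seq y m ℚ.- seq y n) ∣
      ≤⟨ ℚ.∣p+q∣≤∣p∣+∣q∣ (seq x m ℚ.- seq x n) (seq y m ℚ.- seq y n) ⟩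
    ℚ.∣ seq x m ℚ.- seq x n ∣ ℚ.+ ℚ.∣ seq y m ℚ.- seq y n ∣
      <⟨ ℚ.+-mono-<
           (hx m n (ℕ.m⊔n≤o⇒m≤o M N p) (ℕ.m⊔n≤o⇒m≤o M N q))
           (hy m n (ℕ.m⊔n≤o⇒n≤o M N p) (ℕ.m⊔n≤o⇒n≤o M N q)) ⟩
    ½ ℚ.* ε ℚ.+ ½ ℚ.* ε
      ≡⟨ ½*+½* ε ⟩
    ε ∎
    where open ℚ.≤-Reasoning

-ᵣ_ : ℝ → ℝ
-ᵣ x = mkℝ (λ n → ℚ.- seq x n) -‿cauchy
  where
  -‿cauchy : IsCauchy (λ n → ℚ.- seq x n)
  -‿cauchy ε 0<ε with cauchy x ε 0<ε
  ... | N , h = N , λ m n p q →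
    subst (ℚ._< ε)
      (sym (trans (cong ℚ.∣_∣ (neg-diff (seq x m) (seq x n)))
                  (ℚ.∣-p∣≡∣p∣ (seq x m ℚ.- seq x n))))
      (h m n p q)

_-ᵣ_ : ℝ → ℝ → ℝ
x -ᵣ y = x +ᵣ (-ᵣ y)

_/2 : ℝ → ℝ
x /2 = mkℝ (λ n → ½ ℚ.* seq x n) half-cauchy
  where
  half-cauchy : IsCauchy (λ n → ½ ℚ.* seq x n)
  half-cauchy ε 0<ε with cauchy x (ε ℚ.+ ε) (ℚ.+-mono-< 0<ε 0<ε)
  ... | N , h = N , λ m n p q → begin-strict
    ℚ.∣ ½ ℚ.* seq x m ℚ.- ½ ℚ.* seq x n ∣
      ≡⟨ cong ℚ.∣_∣ (half-diff (seq x m) (seq x n)) ⟩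
    ℚ.∣ ½ ℚ.* (seq x m ℚ.- seq x n) ∣
      ≡⟨ ℚ.∣p*q∣≡∣p∣*∣q∣ ½ (seq x m ℚ.- seq x n) ⟩
    ½ ℚ.* ℚ.∣ seq x m ℚ.- seq x n ∣
      <⟨ ℚ.*-monoʳ-<-pos ½ (h m n p q) ⟩
    ½ ℚ.* (ε ℚ.+ ε)
      ≡⟨ ℚ.*-distribˡ-+ ½ ε ε ⟩
    ½ ℚ.* ε ℚ.+ ½ ℚ.* ε
      ≡⟨ ½*+½* ε ⟩
    ε ∎
    where open ℚ.≤-Reasoning

sumᵣ : List ℝ → ℝ
sumᵣ = foldr _+ᵣ_ 0ᵣ

------------------------------------------------------------------------
-- Finite simple graphs, with vertex set Fin n

record SimpleGraph (n : ℕ) : Set₁ where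
  field
    _~_     : Rel (Fin n) 0ℓ
    _~?_    : Decidable _~_
    ~-sym   : Symmetric _~_
    ~-irrefl : ∀ v → ¬ (v ~ v)

open SimpleGraph using (_~_; _~?_)

-- The undirected edge {src , tgt} is stored once, with src < tgt.  The
-- proofs are irrelevant, so an edge is determined by its endpoints.

record Edge {n} (G : SimpleGraph n) : Set where
  constructor edge
  field
    src tgt   : Fin n
    .ordered  : src Fin.< tgt
    .adjacent : _~_ G src tgt

module _ {n} (G : SimpleGraph n) where

  edge? : Fin n × Fin n → Maybe (Edge G)
  edge? (u , v) = Maybe.map (λ (u<v , u~v) → edge u v u<v u~v)
    (dec⇒maybe ((u Fin.<? v) ×-dec _~?_ G u v))

  edges : List (Edge G)
  edges = mapMaybe edge? (cartesianProduct (allFin n) (allFin n))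

  numEdges : ℕ
  numEdges = length edges

  degree : Fin n → ℕ
  degree v = length (filter (_~?_ G v) (allFin n))

  -- The seed n is never the minimum if there is a vertex, as every
  -- degree is less than n.
  minDegree : ℕ
  minDegree = min n (map degree (allFin n))

  Connected : Set
  Connected = ∀ u v → Star (_~_ G) u v

  Incident : Fin n → Edge G → Set
  Incident v e = v ≡ Edge.src e ⊎ v ≡ Edge.tgt e

  incident? : ∀ v e → Dec (Incident v e)
  incident? v e = (v Fin.≟ Edge.src e) ⊎-dec (v Fin.≟ Edge.tgt e)

-- A subgraph is a set of vertices together with a set of edges among
-- them.  The edge set is kept as a graph on the vertices of G, in which
-- the vertices outside the subgraph are isolated.

record Subgraph {n} (G : SimpleGraph n) : Set₁ where
  field
    vertices  : Subset n
    edgeGraph : SimpleGraph n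
    ~⇒~       : ∀ {u v} → _~_ edgeGraph u v → _~_ G u v
    ~⇒∈       : ∀ {u v} → _~_ edgeGraph u v → u ∈ vertices × v ∈ vertices

module _ {n} {G : SimpleGraph n} (L : Subgraph G) where
  open Subgraph L

  maxDegreeₛ : ℕ
  maxDegreeₛ =
    max 0 (map (degree edgeGraph) (filter (_∈? vertices) (allFin n)))

  numEdgesₛ : ℕ
  numEdgesₛ = numEdges edgeGraph

-- Lengths of paths and cycles count edges.

record Path {n} (G : SimpleGraph n) : Set where
  field
    pathLength : ℕ
    vertex     : Fin (suc pathLength) → Fin n
    distinct   : Injective _≡_ _≡_ vertex
    step       : ∀ i → _~_ G (vertex (inject₁ i)) (vertex (Fin.suc i))

-- A path on at least three vertices closed up by one further edge.

record Cycle {n} (G : SimpleGraph n) : Set where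
  field
    path : Path G
  open Path path
  field
    long   : 2 ℕ.≤ pathLength
    closes : _~_ G (vertex (fromℕ pathLength)) (vertex Fin.zero)

  cycleLength : ℕ
  cycleLength = suc pathLength

open Path public using (pathLength)
open Cycle public using (cycleLength)

------------------------------------------------------------------------
-- Fractional matchings

module _ {n} (G : SimpleGraph n) where

  totalWeight : (Edge G → ℝ) → ℝ
  totalWeight f = sumᵣ (map f (edges G))

  weightAt : (Edge G → ℝ) → Fin n → ℝ
  weightAt f v = sumᵣ (map f (filter (incident? G v) (edges G)))

  IsFractionalMatching : (Edge G → ℝ) → Set
  IsFractionalMatching f =
    (∀ e → 0ᵣ ≤ᵣ f e × f e ≤ᵣ 1ᵣ) × (∀ v → weightAt f v ≤ᵣ 1ᵣ)

  -- μ is the maximum of the total weights of fractional matchings of G;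
  -- as a maximum it is unique up to _≃ᵣ_.
  IsFractionalMatchingNumber : ℝ → Set
  IsFractionalMatchingNumber μ =
    (∃ λ f → IsFractionalMatching f × totalWeight f ≃ᵣ μ) ×
    (∀ f → IsFractionalMatching f → totalWeight f ≤ᵣ μ)

{-# OPTIONS --safe #-}
-- A list of arcs (adjacent ordered pairs) in which every vertex occurs at
-- most twice gives a fractional matching: an edge gets half the number of
-- times it is listed.  Hence μ ≥ m/2 for a list of length m.  The edges
-- of a subgraph of maximum degree at most 2 are such a list.
--
-- For the minimum degree bounds, let the list be a matching of the
-- bipartite double cover (distinct tails, distinct heads) of length
-- m < min(2δ, n).  Some u is not a tail and some w is not a head.  If no
-- augmenting path of length 1 or 3 joins u to w, then the arcs with head in
-- N(u) and those with tail in N(w) are disjoint sets of at least δ arcs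
-- each, so 2δ ≤ m.  Therefore μ ≥ min(2δ, n)/2.
module Submission where

open import Defs
open import Data.Fin.Base as Fin using (Fin)
import Data.Fin.Properties as Fin
open import Data.Fin.Subset.Properties using (_∈?_)
open import Data.Integer.Base as ℤ using (+_)
import Data.Integer.Properties as ℤ
open import Data.List.Base
  using (List; []; _∷_; _++_; [_]; map; filter; mapMaybe; length; lookup; allFin)
import Data.List.Extrema as Extrema
import Data.List.Membership.DecPropositional as DecMembership
open import Data.List.Membership.Propositional using (_∈_; _∉_; find; lose)
open import Data.List.Membership.Propositional.Properties
  using (∈-lookup; ∈-map⁺; ∈-map⁻; ∈-filter⁺; ∈-filter⁻; ∈-allFin; ∈-∃++;
         ∈-cartesianProduct⁺)
open import Data.List.Properties
  using (length-map; length-tabulate; filter-none; filter-some)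
open import Data.List.Relation.Binary.Permutation.Propositional
  using (_↭_; ↭-sym; ↭⇒↭ₛ)
open import Data.List.Relation.Binary.Permutation.Propositional.Properties
  using (All-resp-↭; ∈-resp-↭; ↭-length; shift)
  renaming (map⁺ to ↭-map⁺)
import Data.List.Relation.Binary.Permutation.Setoid.Properties as Permutation
open import Data.List.Relation.Unary.All as All using (All; []; _∷_)
import Data.List.Relation.Unary.All.Properties as All
open import Data.List.Relation.Unary.AllPairs using ([]; _∷_)
open import Data.List.Relation.Unary.Any as Any using (Any; here; there)
import Data.List.Relation.Unary.Any.Properties as Any
open import Data.List.Relation.Unary.Unique.Propositional using (Unique)
import Data.List.Relation.Unary.Unique.Propositional.Properties as Unique
open import Data.Maybe.Base using (just; nothing)
import Data.Maybe.Relation.Unary.Any as MaybeAny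
open import Data.Nat.Base using (ℕ; zero; suc; z≤n; s≤s; _≤_; _<_; _*_; _+_; _⊔_)
import Data.Nat.Properties as ℕ
open import Data.Nat.ListAction using (sum)
open import Data.Product.Base using (∃; _×_; _,_; proj₁; proj₂)
open import Data.Product.Properties using (≡-dec)
open import Data.Rational.Base as ℚ using (ℚ; 0ℚ; 1ℚ; ½)
import Data.Rational.Properties as ℚ
open import Data.Rational.Solver using (module +-*-Solver)
open import Data.Rational.Unnormalised.Base as ℚᵘ using (mkℚᵘ; *≡*)
import Data.Rational.Unnormalised.Properties as ℚᵘ
open import Data.Sum.Base using (_⊎_; inj₁; inj₂; [_,_]′)
open import Function.Base using (_∘_; id)
open import Function.Definitions using (Injective)
open import Level using (0ℓ)
open import Relation.Binary.Core using (REL)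
open import Relation.Binary.Definitions using (tri<; tri≈; tri>)
open import Relation.Binary.PropositionalEquality
  using (_≡_; _≢_; refl; sym; trans; cong; cong₂; subst; setoid; module ≡-Reasoning)
open import Relation.Nullary
  using (¬_; Dec; yes; no; contradiction; ¬?; recompute; _×-dec_; _⊎-dec_;
         decidable-stable)
open import Relation.Unary using (Pred; Decidable; _⊆_)

open SimpleGraph using (_~_; _~?_)

private
  variable
    A B : Set
    n : ℕ

-- Counting in lists

lookup-injective : {xs : List A} → Unique xs → Injective _≡_ _≡_ (lookup xs)
lookup-injective (x∉ ∷ u) {Fin.zero}  {Fin.zero}  eq = refl
lookup-injective (x∉ ∷ u) {Fin.zero}  {Fin.suc j} eq =
  contradiction eq (All.lookup x∉ (∈-lookup j))
lookup-injective (x∉ ∷ u) {Fin.suc i} {Fin.zero}  eq =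
  contradiction (sym eq) (All.lookup x∉ (∈-lookup i))
lookup-injective (x∉ ∷ u) {Fin.suc i} {Fin.suc j} eq =
  cong Fin.suc (lookup-injective u eq)

-- Each entry of `xs` is sent to the position of a related entry of `ys`. Since no `y` is related to
-- two different `x`, this is an injection of positions, and `ys` may contain repetitions.
pigeonhole : {xs : List A} {ys : List B} (R : REL A B 0ℓ) → Unique xs →
  (∀ {x x′ y} → R x y → R x′ y → x ≡ x′) →
  (∀ {x} → x ∈ xs → Any (R x) ys) → length xs ≤ length ys
pigeonhole {xs = xs} {ys} R u inj f = Fin.injective⇒≤ {f = g} g-injective
  where
  g : Fin (length xs) → Fin (length ys)
  g i = Any.index (f (∈-lookup i))

  R-g : ∀ i → R (lookup xs i) (lookup ys (g i))
  R-g i = Any.lookup-index (f (∈-lookup i))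

  g-injective : Injective _≡_ _≡_ g
  g-injective {i} {j} eq = lookup-injective u
    (inj (R-g i) (subst (R (lookup xs j) ∘ lookup ys) (sym eq) (R-g j)))

count-unique≤1 : {P : Pred A 0ℓ} (P? : Decidable P) {xs : List A} → Unique xs →
  (∀ {x x′} → P x → P x′ → x ≡ x′) → length (filter P? xs) ≤ 1
-- A target list with a single entry turns the pigeonhole bound into 1.
count-unique≤1 {P = P} P? {xs} u inj = pigeonhole {ys = [ 0 ]} (λ x _ → P x)
  (Unique.filter⁺ P? u) inj (λ x∈ → here (proj₂ (∈-filter⁻ P? {xs = xs} x∈)))

module _ {P Q : Pred A 0ℓ} (P? : Decidable P) (Q? : Decidable Q) where

  count-mono : P ⊆ Q → ∀ xs → length (filter P? xs) ≤ length (filter Q? xs)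
  count-mono P⊆Q []       = z≤n
  count-mono P⊆Q (x ∷ xs) with P? x | Q? x
  ... | yes _ | yes _ = s≤s (count-mono P⊆Q xs)
  ... | yes p | no ¬q = contradiction (P⊆Q p) ¬q
  ... | no _  | yes _ = ℕ.m≤n⇒m≤1+n (count-mono P⊆Q xs)
  ... | no _  | no _  = count-mono P⊆Q xs

  count-⊎ : ∀ xs → length (filter (λ x → P? x ⊎-dec Q? x) xs) ≤
                   length (filter P? xs) + length (filter Q? xs)
  count-⊎ []       = z≤n
  count-⊎ (x ∷ xs) with P? x | Q? x
  ... | yes _ | yes _ = s≤s (ℕ.≤-trans (count-⊎ xs) (ℕ.+-monoʳ-≤ _ (ℕ.n≤1+n _)))
  ... | yes _ | no _  = s≤s (count-⊎ xs)
  ... | no _  | yes _ =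
    ℕ.≤-trans (s≤s (count-⊎ xs)) (ℕ.≤-reflexive (sym (ℕ.+-suc _ _)))
  ... | no _  | no _  = count-⊎ xs

  count-disjoint : ∀ {xs} → All (λ x → ¬ (P x × Q x)) xs →
    length (filter P? xs) + length (filter Q? xs) ≤ length xs
  count-disjoint []                    = z≤n
  count-disjoint {x ∷ xs} (¬pq ∷ ¬pqs) with P? x | Q? x
  ... | yes p | yes q = contradiction (p , q) ¬pq
  ... | yes _ | no _  = s≤s (count-disjoint ¬pqs)
  ... | no _  | yes _ =
    ℕ.≤-trans (ℕ.≤-reflexive (ℕ.+-suc _ _)) (s≤s (count-disjoint ¬pqs))
  ... | no _  | no _  = ℕ.m≤n⇒m≤1+n (count-disjoint ¬pqs)

count-map : {P : Pred B 0ℓ} (P? : Decidable P) (f : A → B) → ∀ xs →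
  length (filter (P? ∘ f) xs) ≡ length (filter P? (map f xs))
count-map P? f []       = refl
count-map P? f (x ∷ xs) with P? (f x)
... | yes _ = cong suc (count-map P? f xs)
... | no _  = count-map P? f xs

count-none : {P : Pred A 0ℓ} (P? : Decidable P) {xs : List A} →
  (∀ {x} → x ∈ xs → ¬ P x) → length (filter P? xs) ≡ 0
count-none P? ¬p = cong length (filter-none P? (All.tabulate ¬p))

sum≤count : {P : Pred A 0ℓ} (P? : Decidable P) (g : A → ℕ) →
  (∀ x → g x ≤ 1) → (∀ x → ¬ P x → g x ≡ 0) →
  ∀ xs → sum (map g xs) ≤ length (filter P? xs)
sum≤count P? g g≤1 g≡0 []       = z≤n
sum≤count P? g g≤1 g≡0 (x ∷ xs) with P? x
... | yes _ = ℕ.+-mono-≤ (g≤1 x) (sum≤count P? g g≤1 g≡0 xs)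
... | no ¬p rewrite g≡0 x ¬p = sum≤count P? g g≤1 g≡0 xs

length≤sum : (g : A → ℕ) {xs : List A} → All (λ x → 1 ≤ g x) xs →
  length xs ≤ sum (map g xs)
length≤sum g []         = z≤n
length≤sum g (1≤ ∷ 1≤s) = ℕ.+-mono-≤ 1≤ (length≤sum g 1≤s)

module _ {R : REL A B 0ℓ} (R? : ∀ x y → Dec (R x y)) where

  -- Both sides count the related pairs, by rows and by columns. A new `x` adds one row, and `row`
  -- distributes it over the column sums.
  double-counting : ∀ xs ys →
    sum (map (λ x → length (filter (R? x) ys)) xs) ≡
    sum (map (λ y → length (filter (λ x → R? x y) xs)) ys)
  double-counting [] ys = sym (zeros ys)
    where
    zeros : (zs : List B) → sum (map (λ _ → 0) zs) ≡ 0
    zeros []       = refl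
    zeros (_ ∷ zs) = zeros zs
  double-counting (x ∷ xs) ys =
    trans (cong (_+_ (length (filter (R? x) ys))) (double-counting xs ys)) (row ys)
    where
    col : B → ℕ
    col y = length (filter (λ x → R? x y) xs)

    col+ : B → ℕ
    col+ y = length (filter (λ x → R? x y) (x ∷ xs))

    swap-sums : ∀ a b c → a + (b + c) ≡ b + (a + c)
    swap-sums a b c =
      trans (sym (ℕ.+-assoc a b c))
        (trans (cong (_+ c) (ℕ.+-comm a b)) (ℕ.+-assoc b a c))

    row : ∀ zs → length (filter (R? x) zs) + sum (map col zs) ≡ sum (map col+ zs)
    row []       = refl
    row (z ∷ zs) with R? x z
    ... | yes _ = cong suc
      (trans (swap-sums (length (filter (R? x) zs)) (col z) _) (cong (_+_ (col z)) (row zs)))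
    ... | no _  =
      trans (swap-sums (length (filter (R? x) zs)) (col z) _) (cong (_+_ (col z)) (row zs))

-- Rational and real arithmetic

ι : ℕ → ℚ
ι m = + m ℚ./ 1

-- Every weight below is a multiple of one half, so that bounds on weights become inequalities
-- between natural numbers.
half : ℕ → ℚ
half m = ½ ℚ.* ι m

-- Division in `ℚ` normalises by a gcd, which is stuck on a variable `m`. Passing to unnormalised
-- rationals avoids it; the 0 there encodes the denominator 1.
toℚᵘ-ι : ∀ m → ℚ.toℚᵘ (ι m) ℚᵘ.≃ mkℚᵘ (+ m) 0
toℚᵘ-ι m = ℚ.toℚᵘ-fromℚᵘ (mkℚᵘ (+ m) 0)

ι-+ : ∀ a b → ι (a + b) ≡ ι a ℚ.+ ι b
ι-+ a b = ℚ.toℚᵘ-injective (begin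
  ℚ.toℚᵘ (ι (a + b))                 ≈⟨ toℚᵘ-ι (a + b) ⟩
  mkℚᵘ (+ (a + b)) 0                 ≈⟨ *≡* (cong (ℤ._* + 1) a+b≡) ⟩
  mkℚᵘ (+ a) 0 ℚᵘ.+ mkℚᵘ (+ b) 0     ≈⟨ ℚᵘ.+-cong (toℚᵘ-ι a) (toℚᵘ-ι b) ⟨
  ℚ.toℚᵘ (ι a) ℚᵘ.+ ℚ.toℚᵘ (ι b)     ≈⟨ ℚ.toℚᵘ-homo-+ (ι a) (ι b) ⟨
  ℚ.toℚᵘ (ι a ℚ.+ ι b)               ∎)
  where
  open import Relation.Binary.Reasoning.Setoid ℚᵘ.≃-setoid
  a+b≡ : + (a + b) ≡ + a ℤ.* + 1 ℤ.+ + b ℤ.* + 1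
  a+b≡ = sym (cong₂ ℤ._+_ (ℤ.*-identityʳ (+ a)) (ℤ.*-identityʳ (+ b)))

half-+ : ∀ a b → half (a + b) ≡ half a ℚ.+ half b
half-+ a b = trans (cong (½ ℚ.*_) (ι-+ a b)) (ℚ.*-distribˡ-+ ½ (ι a) (ι b))

half-2* : ∀ m → half (2 * m) ≡ ι m
half-2* m = begin
  half (m + (m + 0))    ≡⟨ cong (λ k → half (m + k)) (ℕ.+-identityʳ m) ⟩
  half (m + m)          ≡⟨ half-+ m m ⟩
  half m ℚ.+ half m     ≡⟨ ℚ.*-distribʳ-+ (ι m) ½ ½ ⟨
  1ℚ ℚ.* ι m            ≡⟨ ℚ.*-identityˡ (ι m) ⟩
  ι m                   ∎
  where open ≡-Reasoning

half-mono-≤ : ∀ {a b} → a ≤ b → half a ℚ.≤ half b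
half-mono-≤ {a} {b} a≤b = ℚ.*-monoˡ-≤-nonNeg ½ (ℚ.toℚᵘ-cancel-≤
  (ℚᵘ.≤-respˡ-≃ (ℚᵘ.≃-sym (toℚᵘ-ι a)) (ℚᵘ.≤-respʳ-≃ (ℚᵘ.≃-sym (toℚᵘ-ι b))
    (ℚᵘ.*≤* (ℤ.*-monoʳ-≤-nonNeg (+ 1) (ℤ.+≤+ a≤b))))))

-- Comparison of reals through their sequences

p≤q⇒p≤q+ε : ∀ {p q ε} → p ℚ.≤ q → 0ℚ ℚ.< ε → p ℚ.≤ q ℚ.+ ε
p≤q⇒p≤q+ε {p} {q} {ε} p≤q 0<ε = begin
  p            ≡⟨ ℚ.+-identityʳ p ⟨
  p ℚ.+ 0ℚ     ≤⟨ ℚ.+-mono-≤ p≤q (ℚ.<⇒≤ 0<ε) ⟩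
  q ℚ.+ ε      ∎
  where open ℚ.≤-Reasoning

seq-≤⇒≤ᵣ : (x y : ℝ) → (∀ i → seq x i ℚ.≤ seq y i) → x ≤ᵣ y
seq-≤⇒≤ᵣ x y x≤y ε 0<ε = 0 , λ i _ → p≤q⇒p≤q+ε (x≤y i) 0<ε

seq-≤-≤ᵣ-trans : (x y z : ℝ) → (∀ i → seq x i ℚ.≤ seq y i) → y ≤ᵣ z → x ≤ᵣ z
seq-≤-≤ᵣ-trans x y z x≤y y≤z ε 0<ε with y≤z ε 0<ε
... | N , h = N , λ i N≤i → ℚ.≤-trans (x≤y i) (h i N≤i)

½*-pos : ∀ {ε} → 0ℚ ℚ.< ε → 0ℚ ℚ.< ½ ℚ.* ε
½*-pos {ε} 0<ε = subst (ℚ._< ½ ℚ.* ε) (ℚ.*-zeroʳ ½) (ℚ.*-monoʳ-<-pos ½ 0<ε)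

<ᵣ-≤ᵣ-trans : (x y z : ℝ) → x <ᵣ y → y ≤ᵣ z → x <ᵣ z
<ᵣ-≤ᵣ-trans x y z (ε , 0<ε , M , x<y) y≤z with y≤z (½ ℚ.* ε) (½*-pos 0<ε)
-- Half of the gap between `x` and `y` pays for the slack in `y ≤ᵣ z`; the other half remains as the
-- gap between `x` and `z`.
... | N , h = ½ ℚ.* ε , ½*-pos 0<ε , M ⊔ N , λ i ≤i →
  begin
    seq x i ℚ.+ ½ ℚ.* ε                ≡⟨ split (seq x i) ε ⟩
    seq x i ℚ.+ ε ℚ.- ½ ℚ.* ε          ≤⟨ ℚ.+-monoˡ-≤ _ (x<y i (ℕ.m⊔n≤o⇒m≤o M N ≤i)) ⟩
    seq y i ℚ.- ½ ℚ.* ε                ≤⟨ ℚ.+-monoˡ-≤ _ (h i (ℕ.m⊔n≤o⇒n≤o M N ≤i)) ⟩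
    seq z i ℚ.+ ½ ℚ.* ε ℚ.- ½ ℚ.* ε    ≡⟨ cancel (seq z i) (½ ℚ.* ε) ⟩
    seq z i                            ∎
  where
  open ℚ.≤-Reasoning
  open +-*-Solver
  split : ∀ a ε → a ℚ.+ ½ ℚ.* ε ≡ a ℚ.+ ε ℚ.- ½ ℚ.* ε
  split = solve 2 (λ a ε → a :+ con ½ :* ε := a :+ ε :- con ½ :* ε) refl
  cancel : ∀ a b → a ℚ.+ b ℚ.- b ≡ a
  cancel = solve 2 (λ a b → a :+ b :- b := a) refl

[m-k]/2<half : ∀ m k → 0ᵣ <ᵣ k → (fromNat m -ᵣ k) /2 <ᵣ fromℚ (half m)
-- From `N` on, `k` is at least ε, so halving leaves a gap of ½ε. The summand 0 is kept because the
-- hypothesis supplies the bound in the form 0 + ε.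
[m-k]/2<half m k (ε , 0<ε , N , ε≤k) = ½ ℚ.* ε , ½*-pos 0<ε , N , λ i N≤i → begin
  ½ ℚ.* (ι m ℚ.- seq k i) ℚ.+ ½ ℚ.* ε
    ≡⟨ rearrange (ι m) (seq k i) ε ⟩
  ½ ℚ.* (ι m ℚ.- seq k i ℚ.+ (0ℚ ℚ.+ ε))
    ≤⟨ ℚ.*-monoˡ-≤-nonNeg ½ (ℚ.+-monoʳ-≤ (ι m ℚ.- seq k i) (ε≤k i N≤i)) ⟩
  ½ ℚ.* (ι m ℚ.- seq k i ℚ.+ seq k i)
    ≡⟨ cong (½ ℚ.*_) (cancel (ι m) (seq k i)) ⟩
  half m ∎
  where
  open ℚ.≤-Reasoning
  open +-*-Solver
  rearrange : ∀ a b c →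
    ½ ℚ.* (a ℚ.- b) ℚ.+ ½ ℚ.* c ≡ ½ ℚ.* (a ℚ.- b ℚ.+ (0ℚ ℚ.+ c))
  rearrange = solve 3 (λ a b c →
    con ½ :* (a :- b) :+ con ½ :* c := con ½ :* (a :- b :+ (con 0ℚ :+ c))) refl
  cancel : ∀ a b → a ℚ.- b ℚ.+ b ≡ a
  cancel = solve 2 (λ a b → a :- b :+ b := a) refl

seq-sumᵣ-half : (w : A → ℕ) → ∀ xs i →
  seq (sumᵣ (map (fromℚ ∘ half ∘ w) xs)) i ≡ half (sum (map w xs))
seq-sumᵣ-half w []       i = refl
seq-sumᵣ-half w (x ∷ xs) i =
  trans (cong (half (w x) ℚ.+_) (seq-sumᵣ-half w xs i)) (sym (half-+ (w x) _))

-- Edges and arcs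

Arc : ℕ → Set
Arc n = Fin n × Fin n

Touches : Fin n → Arc n → Set
Touches v (u , w) = v ≡ u ⊎ v ≡ w

touches? : (v : Fin n) → Decidable (Touches v)
touches? v (u , w) = (v Fin.≟ u) ⊎-dec (v Fin.≟ w)

module _ (G : SimpleGraph n) where
  open SimpleGraph G using (~-sym; ~-irrefl)

  Adj : Arc n → Set
  Adj (u , w) = _~_ G u w

  ends : Edge G → Arc n
  ends e = Edge.src e , Edge.tgt e

  -- The other two fields of an edge are proof-irrelevant.
  ends-injective : ∀ {e e′} → ends e ≡ ends e′ → e ≡ e′
  ends-injective refl = refl

  -- The stored adjacency proof is irrelevant; decidability of adjacency recovers a usable one.
  Adj-ends : ∀ e → Adj (ends e)
  Adj-ends (edge u w _ u~w) = recompute (_~?_ G u w) u~w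

  Match : Edge G → Arc n → Set
  Match e (u , w) = ends e ≡ (u , w) ⊎ ends e ≡ (w , u)

  match? : ∀ e a → Dec (Match e a)
  match? e (u , w) = (ends e ≟ (u , w)) ⊎-dec (ends e ≟ (w , u))
    where
    _≟_ = ≡-dec Fin._≟_ Fin._≟_

  -- An edge is stored with its smaller endpoint first, so two opposite orientations would give both
  -- `u < w` and `w < u`.
  src≢swap : ∀ e e′ {u w} → ends e ≡ (u , w) → ¬ ends e′ ≡ (w , u)
  src≢swap (edge u w u<w _) (edge _ _ w<u _) refl refl =
    Fin.<-asym (recompute (u Fin.<? w) u<w) (recompute (w Fin.<? u) w<u)

  Match-injective : ∀ a {e e′} → Match e a → Match e′ a → e ≡ e′
  Match-injective a          (inj₁ p) (inj₁ q) = ends-injective (trans p (sym q))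
  Match-injective a          (inj₂ p) (inj₂ q) = ends-injective (trans p (sym q))
  Match-injective a {e} {e′} (inj₁ p) (inj₂ q) = contradiction q (src≢swap e e′ p)
  Match-injective a {e} {e′} (inj₂ p) (inj₁ q) = contradiction p (src≢swap e′ e q)

  Match⇒Touches : ∀ v e a → Incident G v e → Match e a → Touches v a
  Match⇒Touches v e a i        (inj₁ refl) = i
  Match⇒Touches v e a (inj₁ p) (inj₂ refl) = inj₂ p
  Match⇒Touches v e a (inj₂ p) (inj₂ refl) = inj₁ p

  edge?-ends : ∀ {a e} → edge? G a ≡ just e → ends e ≡ a
  edge?-ends {u , w} eq with (u Fin.<? w) ×-dec _~?_ G u w
  edge?-ends {u , w} refl | yes _ = refl

  -- By `edge?-ends` an edge determines the pair it came from, so distinct pairs yield distinct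
  -- edges.
  edges-unique : Unique (edges G)
  edges-unique = go (Unique.cartesianProduct⁺ (Unique.allFin⁺ n) (Unique.allFin⁺ n))
    where
    fresh : ∀ {a e as} → edge? G a ≡ just e → All (a ≢_) as →
      All (e ≢_) (mapMaybe (edge? G) as)
    fresh p []                      = []
    fresh p (_∷_ {x = b} a≢b a∉as) with edge? G b in q
    ... | nothing = fresh p a∉as
    ... | just _  =
      (λ { refl → a≢b (trans (sym (edge?-ends p)) (edge?-ends q)) }) ∷ fresh p a∉as

    go : ∀ {as} → Unique as → Unique (mapMaybe (edge? G) as)
    go []                     = []
    go (_∷_ {x = a} a∉as u) with edge? G a in p
    ... | nothing = go u
    ... | just _  = fresh p a∉as ∷ go u

  edge-between : ∀ {u w} → u Fin.< w → _~_ G u w →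
    Any (λ e → ends e ≡ (u , w)) (edges G)
  edge-between {u} {w} u<w u~w = Any.mapMaybe⁺ (edge? G) _
    (Any.map⁺ (lose (∈-cartesianProduct⁺ (∈-allFin u) (∈-allFin w)) found))
    where
    found : MaybeAny.Any (λ e → ends e ≡ (u , w)) (edge? G (u , w))
    found with (u Fin.<? w) ×-dec _~?_ G u w
    ... | yes _ = MaybeAny.just refl
    ... | no ¬p = contradiction (u<w , u~w) ¬p

  arc-matched : ∀ {a} → Adj a → Any (λ e → Match e a) (edges G)
  arc-matched {u , w} u~w with Fin.<-cmp u w
  ... | tri< u<w _ _  = Any.map inj₁ (edge-between u<w u~w)
  ... | tri≈ _ refl _ = contradiction u~w (~-irrefl u)
  ... | tri> _ _ w<u  = Any.map inj₂ (edge-between w<u (~-sym u~w))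

  -- Pairs of an edge and an arc matching it are counted twice. Every arc matches some edge, so the
  -- total weight is at least half the length. At `v` only arcs touching `v` contribute, each
  -- through at most one edge, so the weight there is at most 2/2.
  half-length≤μ : ∀ {μ} → IsFractionalMatchingNumber G μ → ∀ as → All Adj as →
    (∀ v → length (filter (touches? v) as) ≤ 2) →
    fromℚ (half (length as)) ≤ᵣ μ
  half-length≤μ {μ} (_ , upper) as adj ≤2 =
    seq-≤-≤ᵣ-trans (fromℚ (half (length as))) (totalWeight G f) μ
      total (upper f (bounds , atVertex))
    where
    w : Edge G → ℕ
    w e = length (filter (match? e) as)

    f : Edge G → ℝ
    f = fromℚ ∘ half ∘ w

    w≤2 : ∀ e → w e ≤ 2
    -- Every arc matching `e` touches its source, so the bound at that one endpoint suffices.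
    w≤2 e = ℕ.≤-trans
      (count-mono (match? e) (touches? (Edge.src e))
        (λ {a} → Match⇒Touches (Edge.src e) e a (inj₁ refl)) as)
      (≤2 (Edge.src e))

    bounds : ∀ e → 0ᵣ ≤ᵣ f e × f e ≤ᵣ 1ᵣ
    bounds e = seq-≤⇒≤ᵣ 0ᵣ (f e) (λ _ → half-mono-≤ {0} {w e} z≤n)
             , seq-≤⇒≤ᵣ (f e) 1ᵣ (λ _ → half-mono-≤ {w e} {2} (w≤2 e))

    total : ∀ i → half (length as) ℚ.≤ seq (totalWeight G f) i
    total i = subst (half (length as) ℚ.≤_) (sym (seq-sumᵣ-half w (edges G) i))
      (half-mono-≤ (subst (length as ≤_) (sym (double-counting match? (edges G) as))
        (length≤sum _ (All.map (λ u~w → filter-some _ (arc-matched u~w)) adj))))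

    atVertex : ∀ v → weightAt G f v ≤ᵣ 1ᵣ
    atVertex v = seq-≤⇒≤ᵣ (weightAt G f v) 1ᵣ λ i →
      subst (ℚ._≤ 1ℚ) (sym (seq-sumᵣ-half w es i))
        (half-mono-≤ (subst (_≤ 2) (sym (double-counting match? es as))
          (ℕ.≤-trans (sum≤count (touches? v) _ ≤1 ≡0 as) (≤2 v))))
      where
      es : List (Edge G)
      es = filter (incident? G v) (edges G)

      ≤1 : ∀ a → length (filter (λ e → match? e a) es) ≤ 1
      ≤1 a = count-unique≤1 _ (Unique.filter⁺ _ edges-unique) (Match-injective a)

      ≡0 : ∀ a → ¬ Touches v a → length (filter (λ e → match? e a) es) ≡ 0
      ≡0 a ¬t = count-none _ λ {e} e∈ m →
        ¬t (Match⇒Touches v e a (proj₂ (∈-filter⁻ (incident? G v) {xs = edges G} e∈)) m)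

  -- An edge at `v` is sent to its other endpoint `y`. This is injective, as at most one edge
  -- matches `(v , y)`.
  count-incident≤degree : ∀ v →
    length (filter (touches? v) (map ends (edges G))) ≤ degree G v
  count-incident≤degree v = subst (_≤ degree G v) (count-map (touches? v) ends (edges G))
    (pigeonhole (λ e y → Match e (v , y)) (Unique.filter⁺ (touches? v ∘ ends) edges-unique)
      (λ {_} {_} {y} → Match-injective (v , y))
      (λ {e} e∈ → other e (proj₂ (∈-filter⁻ (touches? v ∘ ends) {xs = edges G} e∈))))
    where
    other : ∀ e → Touches v (ends e) →
      Any (λ y → Match e (v , y)) (filter (_~?_ G v) (allFin n))
    other e (inj₁ refl) =
      lose (∈-filter⁺ (_~?_ G v) (∈-allFin (Edge.tgt e)) (Adj-ends e)) (inj₁ refl)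
    other e (inj₂ refl) =
      lose (∈-filter⁺ (_~?_ G v) (∈-allFin (Edge.src e)) (~-sym (Adj-ends e))) (inj₂ refl)

  minDegree≤degree : ∀ v → minDegree G ≤ degree G v
  minDegree≤degree v = All.lookup
    (Extrema.min≤xs ℕ.≤-totalOrder n (map (degree G) (allFin n)))
    (∈-map⁺ (degree G) (∈-allFin v))

-- The maximum ranges over the vertices of `L` alone; any other vertex is isolated in `edgeGraph`
-- and has degree 0.
degree≤maxDegreeₛ : {G : SimpleGraph n} (L : Subgraph G) → ∀ v →
  degree (Subgraph.edgeGraph L) v ≤ maxDegreeₛ L
degree≤maxDegreeₛ {n} L v with v ∈? Subgraph.vertices L
... | yes v∈ = All.lookup (Extrema.xs≤max ℕ.≤-totalOrder 0 _)
  (∈-map⁺ (degree (Subgraph.edgeGraph L)) (∈-filter⁺ (_∈? Subgraph.vertices L) (∈-allFin v) v∈))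
... | no v∉  = ℕ.≤-trans (ℕ.≤-reflexive
  (count-none (_~?_ (Subgraph.edgeGraph L) v) {allFin n}
    λ _ v~w → v∉ (proj₁ (Subgraph.~⇒∈ L v~w))))
  z≤n

-- Matchings of the bipartite double cover

_∈ₗ?_ : (v : Fin n) (xs : List (Fin n)) → Dec (v ∈ xs)
_∈ₗ?_ = DecMembership._∈?_ Fin._≟_

Unique-resp-↭ : {xs ys : List A} → xs ↭ ys → Unique xs → Unique ys
Unique-resp-↭ xs↭ys = Permutation.Unique-resp-↭ (setoid _) (↭⇒↭ₛ xs↭ys)

-- If every vertex occurred, the pigeonhole bound would give `n ≤ length xs`. Membership is
-- decidable on a finite type, so a missing vertex can be found by search.
∃-∉ : (xs : List (Fin n)) → length xs < n → ∃ λ v → v ∉ xs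
∃-∉ {n} xs short = Fin.¬∀⟶∃¬ n (_∈ xs) (_∈ₗ? xs) λ all → ℕ.<⇒≱ short
  (subst (_≤ length xs) (length-tabulate id)
    (pigeonhole _≡_ (Unique.allFin⁺ n) (λ p q → trans p (sym q)) (λ _ → all _)))

module _ (G : SimpleGraph n) where
  open SimpleGraph G using (~-sym)

  tails heads : List (Arc n) → List (Fin n)
  tails = map proj₁
  heads = map proj₂

  -- The double cover has a tail copy and a head copy of each vertex. A vertex may thus occur once
  -- on each side, and an arc may be listed together with its reverse.
  IsMatching : List (Arc n) → Set
  IsMatching as = All (Adj G) as × Unique (tails as) × Unique (heads as)

  IsMatching-resp-↭ : ∀ {as bs} → as ↭ bs → IsMatching as → IsMatching bs
  IsMatching-resp-↭ p (adj , ut , uh) =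
    All-resp-↭ p adj , Unique-resp-↭ (↭-map⁺ proj₁ p) ut , Unique-resp-↭ (↭-map⁺ proj₂ p) uh

  matching-touches≤2 : ∀ {as} → IsMatching as →
    ∀ v → length (filter (touches? v) as) ≤ 2
  matching-touches≤2 {as} (_ , ut , uh) v = ℕ.≤-trans
    (count-⊎ ((v Fin.≟_) ∘ proj₁) ((v Fin.≟_) ∘ proj₂) as)
    (ℕ.+-mono-≤ (once proj₁ ut) (once proj₂ uh))
    where
    once : (f : Arc n → Fin n) → Unique (map f as) →
      length (filter ((v Fin.≟_) ∘ f) as) ≤ 1
    once f u = subst (_≤ 1) (sym (count-map (v Fin.≟_) f as))
      (count-unique≤1 (v Fin.≟_) u (λ p q → trans (sym p) q))

  -- Each neighbour of `v` is the `f`-end of some listed arc, and distinct neighbours need distinct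
  -- arcs. Leaving `f` open covers both tails and heads.
  degree≤count : (f : Arc n → Fin n) → ∀ as v →
    (∀ {x} → _~_ G v x → x ∈ map f as) →
    degree G v ≤ length (filter (_~?_ G v ∘ f) as)
  degree≤count f as v N⊆ = pigeonhole (λ x a → x ≡ f a)
    (Unique.filter⁺ (_~?_ G v) (Unique.allFin⁺ n)) (λ p q → trans p (sym q))
    λ x∈ → let v~x = proj₂ (∈-filter⁻ (_~?_ G v) {xs = allFin n} x∈)
               _ , a∈ , x≡ = ∈-map⁻ f (N⊆ v~x)
           in lose (∈-filter⁺ (_~?_ G v ∘ f) a∈ (subst (_~_ G v) x≡ v~x)) x≡

  -- Augmenting paths

  MatchingOfSize : ℕ → Set
  MatchingOfSize m = ∃ λ as → IsMatching as × length as ≡ m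

  -- Augmentation along the path from the free tail `u` through the head `a` and the tail `b` to the
  -- free head `w`: the arc `(b , a)` gives way to `(u , a)` and `(b , w)`. Among the tails only `u`
  -- is new, and among the heads only `w`.
  reroute : ∀ {b a as u w} → IsMatching ((b , a) ∷ as) →
    u ∉ b ∷ tails as → w ∉ a ∷ heads as → _~_ G u a → _~_ G b w →
    IsMatching ((u , a) ∷ (b , w) ∷ as)
  reroute (_ ∷ adj , ut , a∉ ∷ uh) u∉ w∉ u~a b~w
    = (u~a ∷ b~w ∷ adj)
    , (All.¬Any⇒All¬ _ u∉ ∷ ut)
    , (((λ a≡w → w∉ (here (sym a≡w))) ∷ a∉) ∷ All.¬Any⇒All¬ _ (w∉ ∘ there) ∷ uh)

  -- The middle arc of the path is moved to the front, since being a matching does not depend on the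
  -- order of the list.
  reroute-through : ∀ {as u w} → IsMatching as → u ∉ tails as → w ∉ heads as →
    Any (λ (b , a) → _~_ G u a × _~_ G w b) as → MatchingOfSize (suc (length as))
  reroute-through {as} {u} {w} M u∉ w∉ any with find any
  ... | (b , a) , ba∈ , u~a , w~b with ∈-∃++ ba∈
  ... | ys , zs , refl = (u , a) ∷ (b , w) ∷ ys ++ zs ,
    reroute (IsMatching-resp-↭ p M) (u∉ ∘ ∈-resp-↭ (↭-sym (↭-map⁺ proj₁ p)))
      (w∉ ∘ ∈-resp-↭ (↭-sym (↭-map⁺ proj₂ p))) u~a (~-sym w~b) ,
    cong suc (sym (↭-length p))
    where
    p : ys ++ [ (b , a) ] ++ zs ↭ (b , a) ∷ ys ++ zs
    p = shift (b , a) ys zs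

  -- At least δ arcs have their head in N(u), and at least δ have their tail in N(w). An arc of both
  -- kinds would be the middle of an augmenting path.
  no-augmentation⇒2δ≤ : ∀ as u w →
    (∀ {a} → _~_ G u a → a ∈ heads as) → (∀ {b} → _~_ G w b → b ∈ tails as) →
    ¬ Any (λ (b , a) → _~_ G u a × _~_ G w b) as → 2 * minDegree G ≤ length as
  no-augmentation⇒2δ≤ as u w N[u]⊆heads N[w]⊆tails ¬any = begin
    2 * δ
      ≡⟨ cong (_+_ δ) (ℕ.+-identityʳ δ) ⟩
    δ + δ
      ≤⟨ ℕ.+-mono-≤ (minDegree≤degree G u) (minDegree≤degree G w) ⟩
    degree G u + degree G w
      ≤⟨ ℕ.+-mono-≤ (degree≤count proj₂ as u N[u]⊆heads) (degree≤count proj₁ as w N[w]⊆tails) ⟩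
    length (filter (_~?_ G u ∘ proj₂) as) + length (filter (_~?_ G w ∘ proj₁) as)
      ≤⟨ count-disjoint _ _ (All.¬Any⇒All¬ _ ¬any) ⟩
    length as ∎
    where
    open ℕ.≤-Reasoning
    δ = minDegree G

  -- An arc from `u` to a free head, or from a free tail to `w`, is simply added. Failing both, all
  -- of N(u) are heads and all of N(w) are tails, so either some arc can be rerouted or the list has
  -- length at least 2δ.
  augment-between : ∀ as {u w} → IsMatching as → u ∉ tails as → w ∉ heads as →
    Dec (∃ λ a → _~_ G u a × a ∉ heads as) →
    Dec (∃ λ b → _~_ G w b × b ∉ tails as) →
    Dec (Any (λ (b , a) → _~_ G u a × _~_ G w b) as) →
    length as < 2 * minDegree G → MatchingOfSize (suc (length as))
  augment-between as {u} {w} (adj , ut , uh) u∉ w∉ (yes (a , u~a , a∉)) _ _ _ =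
    (u , a) ∷ as ,
    (u~a ∷ adj , All.¬Any⇒All¬ _ u∉ ∷ ut , All.¬Any⇒All¬ _ a∉ ∷ uh) , refl
  augment-between as {u} {w} (adj , ut , uh) u∉ w∉ (no _) (yes (b , w~b , b∉)) _ _ =
    (b , w) ∷ as ,
    (~-sym w~b ∷ adj , All.¬Any⇒All¬ _ b∉ ∷ ut , All.¬Any⇒All¬ _ w∉ ∷ uh) , refl
  augment-between as M u∉ w∉ (no _) (no _) (yes any) _ = reroute-through M u∉ w∉ any
  augment-between as {u} {w} M u∉ w∉ (no ¬a) (no ¬b) (no ¬any) m<2δ =
    contradiction m<2δ (ℕ.≤⇒≯ (no-augmentation⇒2δ≤ as u w
      (λ {a} u~a → decidable-stable (a ∈ₗ? heads as) (λ a∉ → ¬a (a , u~a , a∉)))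
      (λ {b} w~b → decidable-stable (b ∈ₗ? tails as) (λ b∉ → ¬b (b , w~b , b∉)))
      ¬any))

  augment : ∀ as → IsMatching as → length as < 2 * minDegree G → length as < n →
    MatchingOfSize (suc (length as))
  augment as M m<2δ m<n =
    let u , u∉ = ∃-∉ (tails as) (subst (_< n) (sym (length-map proj₁ as)) m<n)
        w , w∉ = ∃-∉ (heads as) (subst (_< n) (sym (length-map proj₂ as)) m<n)
    in augment-between as M u∉ w∉
      (Fin.any? (λ a → _~?_ G u a ×-dec ¬? (a ∈ₗ? heads as)))
      (Fin.any? (λ b → _~?_ G w b ×-dec ¬? (b ∈ₗ? tails as)))
      (Any.any? (λ (b , a) → _~?_ G u a ×-dec _~?_ G w b) as)
      m<2δ

  -- The empty matching is augmented `m` times. Before each augmentation the length is below `n`, so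
  -- a free tail and a free head exist.
  matching-of-size : ∀ m → m ≤ 2 * minDegree G → m ≤ n → MatchingOfSize m
  matching-of-size zero    _   _   = [] , ([] , [] , []) , refl
  matching-of-size (suc m) <2δ <n =
    let as , M , eq = matching-of-size m (ℕ.<⇒≤ <2δ) (ℕ.<⇒≤ <n)
    in subst (MatchingOfSize ∘ suc) eq (augment as M
         (subst (_< 2 * minDegree G) (sym eq) <2δ) (subst (_< n) (sym eq) <n))

  -- Applied with `m` equal to 2δ when 2δ ≤ n, and to `n` when n ≤ 2δ.
  half≤μ : ∀ {μ} → IsFractionalMatchingNumber G μ →
    ∀ m → m ≤ 2 * minDegree G → m ≤ n → fromℚ (half m) ≤ᵣ μ
  half≤μ {μ} μ! m ≤2δ ≤n =
    let as , M , eq = matching-of-size m ≤2δ ≤n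
    in subst (λ l → fromℚ (half l) ≤ᵣ μ) eq
         (half-length≤μ G {μ} μ! as (proj₁ M) (matching-touches≤2 M))

  pathLength<n : (P : Path G) → pathLength P < n
  pathLength<n P = Fin.injective⇒≤ (Path.distinct P)

theorem2p2 : ∀ {n : ℕ} (G : SimpleGraph n) → Connected G →
    ∀ (k : ℝ) → 0ᵣ <ᵣ k → k <ᵣ fromNat n →
    ∀ (s : ℕ) → 1 ≤ s →
    ∀ (μ : ℝ) → IsFractionalMatchingNumber G μ →
    ((∀ (L : Subgraph G) → maxDegreeₛ L ≤ 2 → 2 * s ≤ numEdgesₛ L → fromNat s ≤ᵣ μ)
    × ((∃ λ (C : Cycle G) → 2 * minDegree G ≤ cycleLength C)
    ⊎ (∃ λ (P : Path G) → 2 * minDegree G ≤ pathLength P)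
    → fromNat (minDegree G) ≤ᵣ μ))
    × ((fromNat n -ᵣ k) /2 <ᵣ fromNat (minDegree G)
    → (fromNat n -ᵣ k) /2 <ᵣ μ)
theorem2p2 {n} G _ k 0<k _ s _ μ μ! = (subgraph , δ≤μ ∘ 2δ≤n) , ii
  where
  δ = minDegree G

  subgraph : ∀ (L : Subgraph G) → maxDegreeₛ L ≤ 2 → 2 * s ≤ numEdgesₛ L → fromNat s ≤ᵣ μ
  subgraph L Δ≤2 2s≤ =
    seq-≤-≤ᵣ-trans (fromNat s) (fromℚ (half (length as))) μ (λ _ → s≤)
      (half-length≤μ G {μ} μ! as
        (All.map⁺ (All.universal (Subgraph.~⇒~ L ∘ Adj-ends H) (edges H)))
        λ v → ℕ.≤-trans (count-incident≤degree H v)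
                (ℕ.≤-trans (degree≤maxDegreeₛ L v) Δ≤2))
    where
    H = Subgraph.edgeGraph L
    -- Each edge of `L` is listed once, in a single orientation, and so gets weight one half.
    as = map (ends H) (edges H)
    s≤ : ι s ℚ.≤ half (length as)
    s≤ = subst (ℚ._≤ half (length as)) (half-2* s)
      (half-mono-≤ (subst (2 * s ≤_) (sym (length-map (ends H) (edges H))) 2s≤))

  δ≤μ : 2 * δ ≤ n → fromNat δ ≤ᵣ μ
  δ≤μ 2δ≤n = subst (λ q → fromℚ q ≤ᵣ μ) (half-2* δ) (half≤μ G {μ} μ! (2 * δ) ℕ.≤-refl 2δ≤n)

  2δ≤n : (∃ λ (C : Cycle G) → 2 * δ ≤ cycleLength C)
       ⊎ (∃ λ (P : Path G) → 2 * δ ≤ pathLength P) → 2 * δ ≤ n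
  -- A cycle has as many vertices as edges, and a path has one more; the vertices are distinct, so
  -- there are at most `n` of them.
  2δ≤n (inj₁ (C , 2δ≤)) = ℕ.≤-trans 2δ≤ (pathLength<n G (Cycle.path C))
  2δ≤n (inj₂ (P , 2δ≤)) = ℕ.≤-trans 2δ≤ (ℕ.<⇒≤ (pathLength<n G P))

  ii : (fromNat n -ᵣ k) /2 <ᵣ fromNat δ → (fromNat n -ᵣ k) /2 <ᵣ μ
  -- If 2δ ≤ n, the assumed bound on δ passes to μ through δ ≤ μ. If n ≤ 2δ, then μ is at least n/2,
  -- which exceeds (n - k)/2 because k is positive.
  ii <δ = [ (λ 2δ≤n → <ᵣ-≤ᵣ-trans ((fromNat n -ᵣ k) /2) (fromNat δ) μ <δ (δ≤μ 2δ≤n))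
          , (λ n≤2δ → <ᵣ-≤ᵣ-trans ((fromNat n -ᵣ k) /2) (fromℚ (half n)) μ
              ([m-k]/2<half n k 0<k) (half≤μ G {μ} μ! n n≤2δ ℕ.≤-refl))
          ]′ (ℕ.≤-total (2 * δ) n)
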